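{- Let $x \equiv a_j \pmod{m_j}$, $j = 1, \ldots, r$, be a covering system, i.e. a finite system of congruences with positive integer moduli such that every integer satisfies at least one of the congruences. Suppose the moduli $m_1, \ldots, m_r$ are pairwise distinct and each $m_j$ is squarefree (not divisible by the square of any prime). Then $\min_{1\le j\le r} m_j \le 118$. -}

module Defs where

open import Data.Nat using (ℕ; _*_; _≥_)
open import Data.Nat.Primality using (Prime)
open import Data.Nat.Divisibility using (_∣_)
open import Data.Integer as ℤ using (ℤ; +_; _-_)
import Data.Integer.Divisibility as ℤ∣
open import Data.Fin using (Fin)
open import Data.Product using (∃-syntax; _×_)
open import Relation.Nullary using (¬_)

SquareFree : ℕ → Set
SquareFree n = ∀ p → Prime p → ¬ ((p * p) ∣ n)

_≡_[mod_] : ℤ → ℤ → ℕ → Set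
x ≡ a [mod m ] = (+ m) ℤ∣.∣ (x - a)

IsCoveringSystem : (r : ℕ) → (Fin r → ℤ) → (Fin r → ℕ) → Set
IsCoveringSystem r a m = (∀ j → m j ≥ 1) × (∀ (x : ℤ) → ∃[ j ] (x ≡ a j [mod m j ]))

{-# OPTIONS --safe #-}
module Submission where

open import Defs
open import Data.Nat using (ℕ; _≤_)
open import Data.Integer using (ℤ)
open import Data.Fin using (Fin)
open import Data.Product using (∃-syntax)
open import Relation.Binary.PropositionalEquality using (_≡_)
open import Function.Definitions using (Injective)

open import Data.Bool.Base using (Bool; T; _∧_; if_then_else_)
open import Data.Bool.Properties using (T-∧)
open import Data.Empty using (⊥; ⊥-elim)
open import Data.Fin.Base using (zero; suc)
open import Data.Fin.Properties using (any?)
import Data.Fin.Properties as Fin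
open import Data.Integer.Base as ℤ using (0ℤ) renaming (+_ to pos)
import Data.Integer.Divisibility as ℤ∣ᵤ
import Data.Integer.Divisibility.Signed as ℤ∣
import Data.Integer.Properties as ℤ
import Data.Integer.Tactic.RingSolver as ℤSolver
open import Data.List.Base using (List; []; _∷_; map; _++_; take; drop; tabulate)
open import Data.List.Membership.Propositional using (_∈_)
open import Data.List.Membership.Propositional.Properties using (∈-++⁺ˡ; ∈-++⁺ʳ)
open import Data.List.Properties using (map-∘; map-id)
open import Data.List.Relation.Unary.All as All using (All; []; _∷_)
open import Data.List.Relation.Unary.All.Properties using (map⁺; ++⁺; tabulate⁺; tabulate⁻)
open import Data.List.Relation.Unary.Any using (here; there)
open import Data.Nat.Base
open import Data.Nat.Coprimality using (coprime-divisor)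
open import Data.Nat.Divisibility
open import Data.Nat.DivMod using (m≡m%n+[m/n]*n; m%n<n)
open import Data.Nat.ListAction using (product)
open import Data.Nat.Primality
open import Data.Nat.Primality.Factorisation using (factorise)
open import Data.Nat.Properties
open import Data.Nat.Tactic.RingSolver using (solve-∀)
open import Data.Product.Base using (∃; _×_; _,_; proj₁; proj₂)
open import Data.Sum.Base using (inj₁; inj₂; [_,_]′)
open import Data.Unit.Base using (⊤; tt)
open import Function.Base using (const; _∘_)
open import Function.Bundles using (Equivalence)
open import Relation.Binary.PropositionalEquality hiding (_≡_)
open import Relation.Nullary
open import Relation.Nullary.Decidable using (¬?; _×-dec_; toWitness)

-- This is a greedy form of the distortion method of Balister, Bollobás, Morris, Sahasrabudhe and Tiba.
-- An integer avoiding all congruences is fixed modulo the primes p = 2, 3, 5, … in turn. Fixing it mod p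
-- falsifies some congruences whose modulus is divisible by p and strips the factor p from the others; a
-- residue mod p is lost only if it satisfies a congruence whose modulus has been reduced to p itself.
-- A potential Φ, which depends only on the multiplicities of the reduced moduli, controls the future losses.
-- Being monotone with superadditive increments, it grows most, summed over the residues mod p, when all the
-- congruences agree mod p; since this worst case is accounted for, some residue keeps Φ below its threshold.
-- By monotonicity the initial Φ is largest when all squarefree moduli ≥ 119 occur. The primes ≤ 13 then
-- contribute Σ 1/d over the d ∣ 30030 with d ≥ 119; afterwards all squarefree moduli may be allowed, so
-- the family is a constant function (a power of 2). Primes below 9240 are treated by fixed-point computation,
-- the larger ones by a second-moment bound, using that at most 480 residues mod 2310 contain primes.
-- With δ = threshold / (cap * modulus): a proportion ≤ δ of residues mod p may be lost without
-- cost, and a congruence survives with probability at most cap / (rest + cap) = 1 / ((1 - δ) p).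
record Step : Set where
  constructor step
  field
    modulus cap rest threshold : ℕ

open Step

-- δ = 0 and δ = 1/5.
plain cut : ℕ → Step
plain p = step p 1 (p ∸ 1) 0
cut   p = step p 5 (4 * p ∸ 5) p

-- An upper bound for the multiplicities when fixing the residue mod `p` falsifies no congruence.
-- The summand `μ d` stays even if `p` divides `d`, so a constant family becomes a constant family
-- of twice the size.
merge : ℕ → (ℕ → ℕ) → ℕ → ℕ
merge p μ d = μ d + μ (p * d)

scale : List Step → ℕ
scale []       = 1
scale (σ ∷ σs) = (rest σ + cap σ) * scale σs

-- If `rest + cap + threshold = cap * p` with `p` the modulus, then dividing by `rest + cap` gives
-- `(N / p - δ) / (1 - δ)`, cut off at 0: the share of residues lost beyond the free allowance `δ`.
excess : Step → ℕ → ℕ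
excess σ N = cap σ * N ∸ threshold σ

-- μ d is the number of congruences whose reduced modulus is d. Everything is multiplied by scale σs,
-- so the integer exists once Φ σs μ < scale σs.
Φ : List Step → (ℕ → ℕ) → ℕ
Φ []       μ = 0
Φ (σ ∷ σs) μ = excess σ (μ (modulus σ)) * scale σs
             + (rest σ * Φ σs μ + cap σ * Φ σs (merge (modulus σ) μ))

-- Monotonicity and convexity of the potential

Φ-mono : ∀ σs {μ ν} → (∀ d → μ d ≤ ν d) → Φ σs μ ≤ Φ σs ν
Φ-mono []       μ≤ν = z≤n
Φ-mono (σ ∷ σs) μ≤ν = +-mono-≤
  (*-monoˡ-≤ (scale σs) (∸-monoˡ-≤ (threshold σ) (*-monoʳ-≤ (cap σ) (μ≤ν (modulus σ)))))
  (+-mono-≤ (*-monoʳ-≤ (rest σ) (Φ-mono σs μ≤ν))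
            (*-monoʳ-≤ (cap σ) (Φ-mono σs λ d → +-mono-≤ (μ≤ν d) (μ≤ν (modulus σ * d)))))

-- A function preserving Square is monotone and has superadditive increments; on ℕ this is
-- convexity.
record Square (a b c d : ℕ) : Set where
  constructor square
  field
    a≤b      : a ≤ b
    a≤c      : a ≤ c
    b+c≤a+d  : b + c ≤ a + d

Square-+ : ∀ {a b c d a′ b′ c′ d′} → Square a b c d → Square a′ b′ c′ d′ →
           Square (a + a′) (b + b′) (c + c′) (d + d′)
Square-+ {a} {b} {c} {d} {a′} {b′} {c′} {d′} (square h₁ h₂ h₃) (square h₁′ h₂′ h₃′) =
  square (+-mono-≤ h₁ h₁′) (+-mono-≤ h₂ h₂′) (begin
    (b + b′) + (c + c′)  ≡⟨ swap b b′ c c′ ⟩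
    (b + c) + (b′ + c′)  ≤⟨ +-mono-≤ h₃ h₃′ ⟩
    (a + d) + (a′ + d′)  ≡⟨ swap a d a′ d′ ⟩
    (a + a′) + (d + d′)  ∎)
  where
  open ≤-Reasoning
  swap : ∀ a b c d → (a + b) + (c + d) ≡ (a + c) + (b + d)
  swap = solve-∀

Square-*ˡ : ∀ k {a b c d} → Square a b c d → Square (k * a) (k * b) (k * c) (k * d)
Square-*ˡ k {a} {b} {c} {d} (square h₁ h₂ h₃) =
  square (*-monoʳ-≤ k h₁) (*-monoʳ-≤ k h₂) (begin
    k * b + k * c  ≡⟨ *-distribˡ-+ k b c ⟨
    k * (b + c)    ≤⟨ *-monoʳ-≤ k h₃ ⟩
    k * (a + d)    ≡⟨ *-distribˡ-+ k a d ⟩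
    k * a + k * d  ∎)
  where open ≤-Reasoning

Square-*ʳ : ∀ k {a b c d} → Square a b c d → Square (a * k) (b * k) (c * k) (d * k)
Square-*ʳ k {a} {b} {c} {d} sq
  rewrite *-comm a k | *-comm b k | *-comm c k | *-comm d k = Square-*ˡ k sq

-- Truncated subtraction is increasing and convex: if neither `b` nor `c` is truncated, `t` cancels;
-- otherwise at most one of the two survives, and it is at most `d ∸ t`.
Square-∸ : ∀ t {a b c d} → Square a b c d → Square (a ∸ t) (b ∸ t) (c ∸ t) (d ∸ t)
Square-∸ t {a} {b} {c} {d} (square h₁ h₂ h₃) =
  square (∸-monoˡ-≤ t h₁) (∸-monoˡ-≤ t h₂) diagonal
  where
  open ≤-Reasoning
  regroup : ∀ x y t → x + y + (t + t) ≡ (x + t) + (y + t)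
  regroup = solve-∀
  m≤m∸t+t : ∀ m → m ≤ m ∸ t + t
  m≤m∸t+t m = ≤-trans (m≤n+m∸n m t) (≤-reflexive (+-comm t (m ∸ t)))
  b≤d : b ≤ d
  b≤d = +-cancelˡ-≤ a b d (≤-trans (≤-trans (≤-reflexive (+-comm a b)) (+-monoʳ-≤ b h₂)) h₃)
  c≤d : c ≤ d
  c≤d = +-cancelˡ-≤ a c d (≤-trans (+-monoˡ-≤ c h₁) h₃)
  diagonal : (b ∸ t) + (c ∸ t) ≤ (a ∸ t) + (d ∸ t)
  diagonal with ≤-total t b | ≤-total t c
  ... | inj₁ t≤b | inj₁ t≤c = +-cancelʳ-≤ (t + t) _ _ (begin
    (b ∸ t) + (c ∸ t) + (t + t)     ≡⟨ regroup (b ∸ t) (c ∸ t) t ⟩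
    (b ∸ t + t) + (c ∸ t + t)       ≡⟨ cong₂ _+_ (m∸n+n≡m t≤b) (m∸n+n≡m t≤c) ⟩
    b + c                           ≤⟨ h₃ ⟩
    a + d                           ≤⟨ +-mono-≤ (m≤m∸t+t a) (m≤m∸t+t d) ⟩
    (a ∸ t + t) + (d ∸ t + t)       ≡⟨ regroup (a ∸ t) (d ∸ t) t ⟨
    (a ∸ t) + (d ∸ t) + (t + t)     ∎)
  ... | inj₂ b≤t | _        rewrite m≤n⇒m∸n≡0 b≤t =
    ≤-trans (∸-monoˡ-≤ t c≤d) (m≤n+m (d ∸ t) (a ∸ t))
  ... | inj₁ _   | inj₂ c≤t rewrite m≤n⇒m∸n≡0 c≤t | +-identityʳ (b ∸ t) =
    ≤-trans (∸-monoˡ-≤ t b≤d) (m≤n+m (d ∸ t) (a ∸ t))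

Φ-convex : ∀ σs {μ ν₁ ν₂ ω} → (∀ d → Square (μ d) (ν₁ d) (ν₂ d) (ω d)) →
           Square (Φ σs μ) (Φ σs ν₁) (Φ σs ν₂) (Φ σs ω)
Φ-convex []       sq = square z≤n z≤n z≤n
Φ-convex (σ ∷ σs) sq = Square-+
  (Square-*ʳ (scale σs) (Square-∸ (threshold σ) (Square-*ˡ (cap σ) (sq (modulus σ)))))
  (Square-+ (Square-*ˡ (rest σ) (Φ-convex σs sq))
            (Square-*ˡ (cap σ) (Φ-convex σs λ d → Square-+ (sq d) (sq (modulus σ * d)))))

-- Averaging over the residues modulo one prime

Σ< : ℕ → (ℕ → ℕ) → ℕ
Σ< zero    f = 0
Σ< (suc n) f = f n + Σ< n f

-- g counts the y < n with V y 1 ≡ 0.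
increments : ∀ σs μ (V : ℕ → ℕ → ℕ) S n →
  (∀ y → y < n → V y 1 ≡ 0 → S ≤ Φ σs (λ d → μ d + V y d)) →
  ∃ λ g → n ≤ g + Σ< n (λ y → V y 1) ×
          g * S + Φ σs μ ≤ g * Φ σs μ + Φ σs (λ d → μ d + Σ< n (λ y → V y d))
increments σs μ V S zero    big = 0 , z≤n , Φ-mono σs (λ d → m≤m+n (μ d) 0)
increments σs μ V S (suc n) big
  with increments σs μ V S n (λ y y<n → big y (m<n⇒m<1+n y<n)) | V n 1 in eq
... | g , count , ineq | suc v =
  g , n<g+ , ≤-trans ineq (+-monoʳ-≤ (g * Φ σs μ) (Φ-mono σs (λ d → +-monoʳ-≤ (μ d) (m≤n+m _ (V n d)))))
  where
  n<g+ : suc n ≤ g + (suc v + Σ< n (λ y → V y 1))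
  n<g+ = ≤-trans (s≤s count) (≤-trans (≤-reflexive (sym (+-suc g _))) (+-monoʳ-≤ g (s≤s (m≤n+m _ v))))
... | g , count , ineq | zero = suc g , s≤s count , (begin
  S + g * S + A          ≡⟨ +-assoc S (g * S) A ⟩
  S + (g * S + A)        ≤⟨ +-mono-≤ (big n ≤-refl eq) ineq ⟩
  X + (g * A + B)        ≡⟨ regroup X (g * A) B ⟩
  g * A + (X + B)        ≤⟨ +-monoʳ-≤ (g * A) convex ⟩
  g * A + (A + B′)       ≡⟨ regroup′ (g * A) A B′ ⟩
  A + g * A + B′         ∎)
  where
  open ≤-Reasoning
  A  = Φ σs μ
  X  = Φ σs (λ d → μ d + V n d)
  B  = Φ σs (λ d → μ d + Σ< n (λ y → V y d))
  B′ = Φ σs (λ d → μ d + (V n d + Σ< n (λ y → V y d)))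
  regroup : ∀ a b c → a + (b + c) ≡ b + (a + c)
  regroup = solve-∀
  regroup′ : ∀ a b c → a + (b + c) ≡ b + a + c
  regroup′ = solve-∀
  interchange : ∀ m a b → (m + a) + (m + b) ≡ m + (m + (a + b))
  interchange = solve-∀
  -- The increment by `V n` at `μ` is at most the increment by `V n` after the earlier `V y` have
  -- been added.
  convex : X + B ≤ A + B′
  convex = Square.b+c≤a+d (Φ-convex σs λ d → square (m≤m+n (μ d) _) (m≤m+n (μ d) _)
                                               (≤-reflexive (interchange (μ d) (V n d) _)))

-- Rules out that every residue fails. Each of the `g` residues without a hit lifts the potential
-- from `A` to `S` or more, whence `g (S - A) ≤ B - A`. At most `N` residues are hit, so `adm` gives
-- `r + l ≤ l g + (l N ∸ t)`, and both together contradict `small`. If `S ≤ A`, then `small` fails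
-- at once.
overfull : ∀ r l t p N M g S A B →
  r + l + t ≤ l * p → p ≤ g + M → M ≤ N →
  (l * N ∸ t) * S + (r * A + l * B) < (r + l) * S →
  g * S + A ≤ g * A + B → A ≤ B → ⊥
overfull r l t p N M g S A B adm cnt M≤N small ineq A≤B with ≤-total S A
... | inj₁ S≤A = <-irrefl refl (begin-strict
  (r + l) * S                          ≡⟨ *-distribʳ-+ S r l ⟩
  r * S + l * S                        ≤⟨ +-mono-≤ (*-monoʳ-≤ r S≤A) (*-monoʳ-≤ l (≤-trans S≤A A≤B)) ⟩
  r * A + l * B                        ≤⟨ m≤n+m _ ((l * N ∸ t) * S) ⟩
  (l * N ∸ t) * S + (r * A + l * B)    <⟨ small ⟩
  (r + l) * S                          ∎)
  where open ≤-Reasoning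
... | inj₂ A≤S with ≤⇒∃+ A≤S
  where
  ≤⇒∃+ : ∀ {m n} → m ≤ n → ∃ λ e → m + e ≡ n
  ≤⇒∃+ {m} {n} m≤n = n ∸ m , m+[n∸m]≡n m≤n
... | e , refl = <-irrefl refl (begin-strict
  (r + l) * (A + e)                                    ≡⟨ *-distribˡ-+ (r + l) A e ⟩
  (r + l) * A + (r + l) * e                            ≤⟨ +-monoʳ-≤ _ (*-monoˡ-≤ e r+l≤) ⟩
  (r + l) * A + (l * g + c) * e                        ≡⟨ regroup r l A e g c ⟩
  c * e + (r * A + l * (g * e + A))
    ≤⟨ +-mono-≤ (*-monoʳ-≤ c (m≤n+m e A)) (+-monoʳ-≤ (r * A) (*-monoʳ-≤ l ge+A≤B)) ⟩
  c * (A + e) + (r * A + l * B)                        <⟨ small ⟩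
  (r + l) * (A + e)                                    ∎)
  where
  open ≤-Reasoning
  c = l * N ∸ t
  regroup : ∀ r l A e g c → (r + l) * A + (l * g + c) * e ≡ c * e + (r * A + l * (g * e + A))
  regroup = solve-∀
  expand : ∀ g A e → g * A + (g * e + A) ≡ g * (A + e) + A
  expand = solve-∀
  ge+A≤B : g * e + A ≤ B
  ge+A≤B = +-cancelˡ-≤ (g * A) _ _ (≤-trans (≤-reflexive (expand g A e)) ineq)
  r+l≤ : r + l ≤ l * g + c
  r+l≤ = +-cancelʳ-≤ t _ _ (begin
    r + l + t              ≤⟨ adm ⟩
    l * p                  ≤⟨ *-monoʳ-≤ l (≤-trans cnt (+-monoʳ-≤ g M≤N)) ⟩
    l * (g + N)            ≡⟨ *-distribˡ-+ l g N ⟩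
    l * g + l * N          ≤⟨ +-monoʳ-≤ (l * g) (m≤n+m∸n (l * N) t) ⟩
    l * g + (t + c)        ≡⟨ cong (l * g +_) (+-comm t c) ⟩
    l * g + (c + t)        ≡⟨ +-assoc (l * g) c t ⟨
    l * g + c + t          ∎)

-- Congruences restricted to a residue class

indicator : ∀ {ℓ} {P : Set ℓ} → Dec P → ℕ
indicator P? = if does P? then 1 else 0

indicator-mono : ∀ {ℓ ℓ′} {P : Set ℓ} {Q : Set ℓ′} (P? : Dec P) (Q? : Dec Q) → (P → Q) →
                 indicator P? ≤ indicator Q?
indicator-mono (no _)  _        P⇒Q = z≤n
indicator-mono (yes p) (yes _)  P⇒Q = ≤-refl
indicator-mono (yes p) (no ¬q)  P⇒Q = contradiction (P⇒Q p) ¬q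

Σ<-+ : ∀ n f g → Σ< n (λ y → f y + g y) ≡ Σ< n f + Σ< n g
Σ<-+ zero    f g = refl
Σ<-+ (suc n) f g rewrite Σ<-+ n f g = swap (f n) (g n) (Σ< n f) (Σ< n g)
  where
  swap : ∀ a b c d → (a + b) + (c + d) ≡ (a + c) + (b + d)
  swap = solve-∀

Σ<-none : ∀ {P : ℕ → Set} (P? : ∀ y → Dec (P y)) n → (∀ {y} → y < n → ¬ P y) →
          Σ< n (λ y → indicator (P? y)) ≡ 0
Σ<-none P? zero    none = refl
Σ<-none P? (suc n) none with P? n
... | yes p = contradiction p (none ≤-refl)
... | no  _ = Σ<-none P? n (λ y<n → none (m<n⇒m<1+n y<n))

Σ<-unique : ∀ {P : ℕ → Set} {Q : Set} (P? : ∀ y → Dec (P y)) (Q? : Dec Q) n →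
            (∀ {y z} → y < z → z < n → P y → ¬ P z) → (∀ {y} → P y → Q) →
            Σ< n (λ y → indicator (P? y)) ≤ indicator Q?
Σ<-unique P? Q? zero    uniq P⇒Q = z≤n
Σ<-unique P? Q? (suc n) uniq P⇒Q with P? n
... | no  _ = Σ<-unique P? Q? n (λ y<z z<n → uniq y<z (m<n⇒m<1+n z<n)) P⇒Q
... | yes p rewrite Σ<-none P? n (λ y<n Py → uniq y<n ≤-refl Py p) =
  indicator-mono (yes p) Q? P⇒Q

Congruence : Set
Congruence = ℕ × ℤ

Avoids : ℤ → Congruence → Set
Avoids x (d , a) = ¬ (pos d ℤ∣ᵤ.∣ x ℤ.- a)

count : List Congruence → ℕ → ℕ
count []            d = 0
count ((e , a) ∷ C) d = indicator (e ≟ d) + count C d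

hit? : ∀ p z d c → Dec (proj₁ c ≡ p * d × p ∣ ℤ.∣ z ℤ.- proj₂ c ∣)
hit? p z d (e , a) = (e ≟ p * d) ×-dec (p ∣? ℤ.∣ z ℤ.- a ∣)

-- These are the congruences that newly arrive at modulus `d` when the residue of `z` mod `p` is
-- fixed. At `d = 1` they are already satisfied, so the residue is lost.
hits : ℕ → ℤ → List Congruence → ℕ → ℕ
hits p z []      d = 0
hits p z (c ∷ C) d = indicator (hit? p z d c) + hits p z C d

restrict : ℕ → ℤ → List Congruence → List Congruence
restrict p z []            = []
restrict p z ((e , a) ∷ C) with p ∣? e
... | no  _             = (e , a) ∷ restrict p z C
... | yes (divides q _) with p ∣? ℤ.∣ z ℤ.- a ∣
...   | yes _ = (q , a) ∷ restrict p z C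
...   | no  _ = restrict p z C

count-restrict : ∀ p z C d → count (restrict p z C) d ≤ count C d + hits p z C d
count-restrict p z []            d = z≤n
count-restrict p z ((e , a) ∷ C) d with p ∣? e
... | no _ = begin
    i + count (restrict p z C) d    ≤⟨ +-monoʳ-≤ i (count-restrict p z C d) ⟩
    i + (count C d + hits p z C d)  ≡⟨ +-assoc i _ _ ⟨
    i + count C d + hits p z C d    ≤⟨ +-monoʳ-≤ (i + count C d) (m≤n+m (hits p z C d) _) ⟩
    i + count C d + (_ + hits p z C d) ∎
  where
  open ≤-Reasoning
  i = indicator (e ≟ d)
... | yes (divides q eq) with p ∣? ℤ.∣ z ℤ.- a ∣ 
...   | no ¬h = ≤-trans (count-restrict p z C d)
    (+-mono-≤ (m≤n+m (count C d) (indicator (e ≟ d)))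
              (m≤n+m (hits p z C d) (indicator (e ≟ p * d ×-dec no ¬h))))
...   | yes h = begin
    indicator (q ≟ d) + count (restrict p z C) d
      ≤⟨ +-mono-≤ (indicator-mono (q ≟ d) (e ≟ p * d ×-dec yes h) λ { refl → trans eq (*-comm q p) , h })
                  (count-restrict p z C d) ⟩
    j + (count C d + hits p z C d)                ≡⟨ rearrange j (count C d) _ ⟩
    count C d + (j + hits p z C d)                ≤⟨ +-monoˡ-≤ _ (m≤n+m (count C d) (indicator (e ≟ d))) ⟩
    indicator (e ≟ d) + count C d + (j + hits p z C d) ∎
  where
  open ≤-Reasoning
  j = indicator (e ≟ p * d ×-dec yes h)
  rearrange : ∀ a b c → a + (b + c) ≡ b + (a + c)
  rearrange = solve-∀

≡-mod-trans : ∀ {k} x y z → pos k ℤ∣ᵤ.∣ x ℤ.- y → pos k ℤ∣ᵤ.∣ y ℤ.- z → pos k ℤ∣ᵤ.∣ x ℤ.- z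
≡-mod-trans {k} x y z k∣x-y k∣y-z = ℤ∣.∣⇒∣ᵤ (subst (pos k ℤ∣.∣_) (telescope x y z)
  (ℤ∣.∣m∣n⇒∣m+n (ℤ∣.∣ᵤ⇒∣ {i = x ℤ.- y} k∣x-y) (ℤ∣.∣ᵤ⇒∣ {i = y ℤ.- z} k∣y-z)))
  where
  telescope : ∀ x y z → (x ℤ.- y) ℤ.+ (y ℤ.- z) ≡ x ℤ.- z
  telescope = ℤSolver.solve-∀

≡-mod-sym : ∀ {k} x y → pos k ℤ∣ᵤ.∣ x ℤ.- y → pos k ℤ∣ᵤ.∣ y ℤ.- x
≡-mod-sym x y = subst (_ ∣_) (ℤ.∣i-j∣≡∣j-i∣ x y)

avoids-restrict : ∀ p x z C → pos p ℤ∣ᵤ.∣ x ℤ.- z → All (Avoids x) (restrict p z C) → All (Avoids x) C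
avoids-restrict p x z []            x≡z avoids = []
avoids-restrict p x z ((e , a) ∷ C) x≡z avoids with p ∣? e | avoids
... | no _ | av ∷ avs = av ∷ avoids-restrict p x z C x≡z avs
... | yes (divides q refl) | avs with p ∣? ℤ.∣ z ℤ.- a ∣ | avs
...   | no ¬h | avs′ = (λ qp∣ → ¬h (≡-mod-trans z x a (≡-mod-sym x z x≡z) (∣-trans (n∣m*n q) qp∣)))
                     ∷ avoids-restrict p x z C x≡z avs′
...   | yes h | av ∷ avs′ = (λ qp∣ → av (∣-trans (m∣m*n p) qp∣)) ∷ avoids-restrict p x z C x≡z avs′

Proper : ℕ → Congruence → Set
Proper P (e , a) = e ∣ P × e ≢ 1

-- A modulus reduced to 1 would have been `p` itself and counted as a hit at 1. A modulus prime to
-- `p` divides `P` by coprimality.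
proper-restrict : ∀ {p} z P C → Prime p → hits p z C 1 ≡ 0 →
                  All (Proper (p * P)) C → All (Proper P) (restrict p z C)
proper-restrict z P [] pr nohit [] = []
proper-restrict {p} z P ((e , a) ∷ C) pr nohit ((e∣pP , e≢1) ∷ proper) with p ∣? e
... | no p∤e = (coprime-divisor coprime e∣pP , e≢1)
             ∷ proper-restrict z P C pr (m+n≡0⇒n≡0 (indicator (hit? p z 1 (e , a))) nohit) proper
  where
  coprime : ∀ {i} → i ∣ e × i ∣ p → i ≡ 1
  coprime (i∣e , i∣p) with prime⇒irreducible pr i∣p
  ... | inj₁ i≡1  = i≡1
  ... | inj₂ refl = contradiction i∣e p∤e
... | yes (divides q eq) with p ∣? ℤ.∣ z ℤ.- a ∣
...   | no ¬h = proper-restrict z P C pr (m+n≡0⇒n≡0 (indicator ((e ≟ p * 1) ×-dec no ¬h)) nohit) proper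
...   | yes h = (q∣P , q≢1)
              ∷ proper-restrict z P C pr (m+n≡0⇒n≡0 (indicator ((e ≟ p * 1) ×-dec yes h)) nohit) proper
  where
  instance _ = prime⇒nonZero pr
  q∣P : q ∣ P
  q∣P = *-cancelˡ-∣ p (subst (_∣ p * P) (trans eq (*-comm q p)) e∣pP)
  q≢1 : q ≢ 1
  q≢1 refl = contradiction
    (≤-trans (indicator-mono (yes tt) ((e ≟ p * 1) ×-dec yes h) (λ _ → trans eq (*-comm 1 p) , h))
             (m≤m+n _ (hits p z C 1)))
    (<⇒≱ (≤-reflexive (cong suc nohit)))

-- Subtracting two hits gives `p ∣ Q * (y′ ∸ y)`, while `p` divides neither factor, as
-- `0 < y′ ∸ y < p`.
at-most-one-hit : ∀ {p Q} x a → Prime p → ¬ p ∣ Q → ∀ {y y′} → y < y′ → y′ < p →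
  p ∣ ℤ.∣ x ℤ.+ pos (Q * y) ℤ.- a ∣ → ¬ p ∣ ℤ.∣ x ℤ.+ pos (Q * y′) ℤ.- a ∣
at-most-one-hit {p} {Q} x a pr p∤Q {y} {y′} y<y′ y′<p h h′ =
  [ p∤Q , p∤k ]′ (euclidsLemma Q k pr p∣Qk)
  where
  k = y′ ∸ y
  p∤k : ¬ p ∣ k
  p∤k p∣k = <⇒≱ (≤-<-trans (m∸n≤m y′ y) y′<p) (∣⇒≤ {{>-nonZero (m<n⇒0<n∸m y<y′)}} p∣k)
  difference : ∀ x u v a → (x ℤ.+ (u ℤ.+ v) ℤ.- a) ℤ.- (x ℤ.+ u ℤ.- a) ≡ v
  difference = ℤSolver.solve-∀
  shift : pos (Q * y′) ≡ pos (Q * y) ℤ.+ pos (Q * k)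
  shift = trans (cong pos (trans (cong (Q *_) (sym (m+[n∸m]≡n (<⇒≤ y<y′)))) (*-distribˡ-+ Q y k)))
                (ℤ.pos-+ (Q * y) (Q * k))
  p∣Qk : p ∣ Q * k
  p∣Qk = ℤ∣.∣⇒∣ᵤ (subst (pos p ℤ∣.∣_)
    (trans (cong (λ u → (x ℤ.+ u ℤ.- a) ℤ.- (x ℤ.+ pos (Q * y) ℤ.- a)) shift)
           (difference x (pos (Q * y)) (pos (Q * k)) a))
    (ℤ∣.∣m∣n⇒∣m-n (ℤ∣.∣ᵤ⇒∣ {i = x ℤ.+ pos (Q * y′) ℤ.- a} h′) (ℤ∣.∣ᵤ⇒∣ {i = x ℤ.+ pos (Q * y) ℤ.- a} h)))

-- Each congruence of modulus `p * d` is hit by at most one of the `p` residues, so the total is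
-- largest when all of them are hit.
Σ<-hits : ∀ {p Q} x C d → Prime p → ¬ p ∣ Q →
          Σ< p (λ y → hits p (x ℤ.+ pos (Q * y)) C d) ≤ count C (p * d)
Σ<-hits {p} x [] d pr p∤Q = ≤-reflexive (zeros p)
  where
  zeros : ∀ n → Σ< n (λ _ → 0) ≡ 0
  zeros zero    = refl
  zeros (suc n) = zeros n
Σ<-hits {p} {Q} x ((e , a) ∷ C) d pr p∤Q = ≤-trans
  (≤-reflexive (Σ<-+ p _ (λ y → hits p (x ℤ.+ pos (Q * y)) C d)))
  (+-mono-≤ (Σ<-unique (λ y → hit? p (x ℤ.+ pos (Q * y)) d (e , a)) (e ≟ p * d) p
               (λ y<y′ y′<p (_ , h) (_ , h′) → at-most-one-hit {Q = Q} x a pr p∤Q y<y′ y′<p h h′) proj₁)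
            (Σ<-hits x C d pr p∤Q))

-- The greedy choice of residues

Admissible : Step → Set
Admissible σ = Prime (modulus σ) × rest σ + cap σ + threshold σ ≤ cap σ * modulus σ

Ascending : ℕ → List ℕ → Set
Ascending n []       = ⊤
Ascending n (p ∷ ps) = n ≤ p × Ascending (suc p) ps

moduli : List Step → List ℕ
moduli = map modulus

-- In the recursion `Q` gathers the primes already treated and `x` is the integer chosen so far;
-- later changes of `x` are multiples of `Q` and keep its residues. The bound `n` on the primes of
-- `Q` makes the next prime coprime to `Q`.
avoid : ∀ σs → All Admissible σs → ∀ {n} → Ascending n (moduli σs) →
        ∀ Q → (∀ {q} → Prime q → q ∣ Q → q < n) →
        ∀ C → All (Proper (product (moduli σs))) C → Φ σs (count C) < scale σs →
        ∀ x → ∃ λ x′ → pos Q ℤ∣ᵤ.∣ x′ ℤ.- x × All (Avoids x′) C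
avoid [] [] asc Q small C proper Φ<1 x =
  x , subst (Q ∣_) (cong ℤ.∣_∣ (sym (ℤ.+-inverseʳ x))) (divides 0 refl)
    , All.map (λ { (e∣1 , e≢1) → contradiction (∣1⇒≡1 e∣1) e≢1 }) proper
avoid (σ ∷ σs) ((pr , adm) ∷ adms) {n} (n≤p , asc) Q small C proper Φ<S x
  with anyUpTo? (λ y → (hits p (z y) C 1 ≟ 0) ×-dec (Φ σs (count (restrict p (z y) C)) <? scale σs)) p
  where
  p = modulus σ
  z : ℕ → ℤ
  z y = x ℤ.+ pos (Q * y)
... | yes (y , y<p , nohit , Φ<) =
  let x′ , x′≡z , avoids = avoid σs adms asc (Q * p) small′ (restrict p z C)
                             (proper-restrict z _ C pr nohit proper) Φ< z
  in x′ , ≡-mod-trans x′ z x (∣-trans (m∣m*n p) x′≡z) z≡x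
        , avoids-restrict p x′ z C (∣-trans (n∣m*n Q) x′≡z) avoids
  where
  p = modulus σ
  z = x ℤ.+ pos (Q * y)
  small′ : ∀ {q} → Prime q → q ∣ Q * p → q < suc p
  small′ prq q∣Qp with euclidsLemma Q p prq q∣Qp
  ... | inj₁ q∣Q = m<n⇒m<1+n (<-≤-trans (small prq q∣Q) n≤p)
  ... | inj₂ q∣p = s≤s (∣⇒≤ {{prime⇒nonZero pr}} q∣p)
  cancel : ∀ x u → (x ℤ.+ u) ℤ.- x ≡ u
  cancel = ℤSolver.solve-∀
  z≡x : pos Q ℤ∣ᵤ.∣ z ℤ.- x
  z≡x = subst (Q ∣_) (cong ℤ.∣_∣ (sym (cancel x (pos (Q * y))))) (m∣m*n y)
-- Every residue is lost or pushes the potential up to `scale σs`; the sum of the increments then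
-- contradicts `Φ<S`.
... | no none =
  let g , p≤g+M , ineq = increments σs (count C) V (scale σs) p stuck
  in ⊥-elim (overfull (rest σ) (cap σ) (threshold σ) p (count C p) _ g (scale σs) (Φ σs (count C)) _
       adm p≤g+M
       (subst (λ m → Σ< p (λ y → V y 1) ≤ count C m) (*-identityʳ p) (Σ<-hits x C 1 pr p∤Q))
       Φ<S
       (≤-trans ineq (+-monoʳ-≤ (g * Φ σs (count C)) (Φ-mono σs λ d → +-monoʳ-≤ (count C d) (Σ<-hits x C d pr p∤Q))))
       (Φ-mono σs λ d → m≤m+n (count C d) _))
  where
  p = modulus σ
  V : ℕ → ℕ → ℕ
  V y d = hits p (x ℤ.+ pos (Q * y)) C d
  p∤Q : ¬ p ∣ Q
  p∤Q p∣Q = <⇒≱ (small pr p∣Q) n≤p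
  stuck : ∀ y → y < p → V y 1 ≡ 0 → scale σs ≤ Φ σs (λ d → count C d + V y d)
  stuck y y<p nohit = ≤-trans (≮⇒≥ (λ Φ< → none (y , y<p , nohit , Φ<)))
                              (Φ-mono σs (count-restrict p _ C))

-- Constant families weighted by polynomials

-- The list u stands for Σ u_w F (2 ^ w * c); mix r l 0 multiplies it by r + l X as a polynomial.
dot : List ℕ → (ℕ → ℕ) → ℕ → ℕ
dot []      F c = 0
dot (x ∷ u) F c = x * F c + dot u F (c + c)

mix : ℕ → ℕ → ℕ → List ℕ → List ℕ
mix r l y []      = l * y ∷ []
mix r l y (x ∷ u) = r * x + l * y ∷ mix r l x u

dot-mix : ∀ r l y u F c → dot (mix r l y u) F c ≡ l * y * F c + (r * dot u F c + l * dot u F (c + c))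
dot-mix r l y []      F c = base r l (l * y * F c)
  where
  base : ∀ r l a → a + 0 ≡ a + (r * 0 + l * 0)
  base = solve-∀
dot-mix r l y (x ∷ u) F c = trans
  (cong ((r * x + l * y) * F c +_) (dot-mix r l x u F (c + c)))
  (ring r l x y (F c) (F (c + c)) (dot u F (c + c)) (dot u F (c + c + (c + c))))
  where
  ring : ∀ r l x y a b d e → (r * x + l * y) * a + (l * x * b + (r * d + l * e)) ≡
         l * y * a + (r * (x * a + d) + l * (x * b + e))
  ring = solve-∀

dot-mono : ∀ u {F G} c → (∀ c → F c ≤ G c) → dot u F c ≤ dot u G c
dot-mono []      c F≤G = z≤n
dot-mono (x ∷ u) c F≤G = +-mono-≤ (*-monoʳ-≤ x (F≤G c)) (dot-mono u (c + c) F≤G)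

dot-+ : ∀ u F G c → dot u (λ c → F c + G c) c ≡ dot u F c + dot u G c
dot-+ []      F G c = refl
dot-+ (x ∷ u) F G c = trans (cong (x * (F c + G c) +_) (dot-+ u F G (c + c))) (ring x (F c) (G c) _ _)
  where
  ring : ∀ x a b d e → x * (a + b) + (d + e) ≡ x * a + d + (x * b + e)
  ring = solve-∀

dot-*ʳ : ∀ u F k c → dot u (λ c → F c * k) c ≡ dot u F c * k
dot-*ʳ []      F k c = refl
dot-*ʳ (x ∷ u) F k c = trans (cong (x * (F c * k) +_) (dot-*ʳ u F k (c + c))) (ring x (F c) k _)
  where
  ring : ∀ x a k d → x * (a * k) + d * k ≡ (x * a + d) * k
  ring = solve-∀

dot-*ˡ : ∀ u F k c → dot u (λ c → k * F c) c ≡ k * dot u F c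
dot-*ˡ u F k c = trans (dot-cong u c (λ c → *-comm k (F c))) (trans (dot-*ʳ u F k c) (*-comm _ k))
  where
  dot-cong : ∀ u {F G} c → (∀ c → F c ≡ G c) → dot u F c ≡ dot u G c
  dot-cong u c F≡G = ≤-antisym (dot-mono u c (≤-reflexive ∘ F≡G)) (dot-mono u c (≤-reflexive ∘ sym ∘ F≡G))

dot-double : ∀ u F c → dot u (λ c → F (c + c)) c ≡ dot u F (c + c)
dot-double []      F c = refl
dot-double (x ∷ u) F c = cong (x * F (c + c) +_) (dot-double u F (c + c))

dot-scale : ∀ k u F c → dot (map (k *_) u) F c ≡ k * dot u F c
dot-scale k []      F c = sym (*-zeroʳ k)
dot-scale k (x ∷ u) F c = trans (cong (k * x * F c +_) (dot-scale k u F (c + c))) (ring k x (F c) _)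
  where
  ring : ∀ k x a d → k * x * a + k * d ≡ k * (x * a + d)
  ring = solve-∀

dot-split : ∀ W u F c → dot u F c ≡ dot (take W u) F c + dot (drop W u) F (2 ^ W * c)
dot-split zero    u       F c = cong (dot u F) (sym (*-identityˡ c))
dot-split (suc W) []      F c = refl
dot-split (suc W) (x ∷ u) F c = trans
  (cong (x * F c +_) (trans (dot-split W u F (c + c))
                            (cong (λ e → dot (take W u) F (c + c) + dot (drop W u) F e) (ring (2 ^ W) c))))
  (sym (+-assoc (x * F c) _ _))
  where
  ring : ∀ a c → a * (c + c) ≡ 2 * a * c
  ring = solve-∀

infixl 7 _⌈/⌉_
_⌈/⌉_ : ℕ → ℕ → ℕ
a ⌈/⌉ zero  = 0
a ⌈/⌉ suc m = (a + m) / suc m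

≤*⌈/⌉ : ∀ a n .{{_ : NonZero n}} → a ≤ n * (a ⌈/⌉ n)
≤*⌈/⌉ a (suc m) = +-cancelʳ-≤ m _ _ (begin
  a + m                                        ≡⟨ m≡m%n+[m/n]*n (a + m) (suc m) ⟩
  (a + m) % suc m + (a + m) / suc m * suc m
    ≤⟨ +-mono-≤ (≤-pred (m%n<n (a + m) (suc m))) (≤-reflexive (*-comm ((a + m) / suc m) (suc m))) ⟩
  m + suc m * ((a + m) / suc m)                ≡⟨ +-comm m _ ⟩
  suc m * ((a + m) / suc m) + m                ∎)
  where open ≤-Reasoning

dot-⌈/⌉ : ∀ n .{{_ : NonZero n}} u F c → dot u F c ≤ n * dot (map (_⌈/⌉ n) u) F c
dot-⌈/⌉ n []      F c = z≤n
dot-⌈/⌉ n (x ∷ u) F c = begin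
  x * F c + dot u F (c + c)                              ≤⟨ +-mono-≤ (*-monoˡ-≤ (F c) (≤*⌈/⌉ x n)) (dot-⌈/⌉ n u F (c + c)) ⟩
  n * (x ⌈/⌉ n) * F c + n * dot (map (_⌈/⌉ n) u) F (c + c)  ≡⟨ ring n (x ⌈/⌉ n) (F c) _ ⟩
  n * ((x ⌈/⌉ n) * F c + dot (map (_⌈/⌉ n) u) F (c + c))    ∎
  where
  open ≤-Reasoning
  ring : ∀ n x a d → n * x * a + n * d ≡ n * (x * a + d)
  ring = solve-∀

sqr : ℕ → ℕ
sqr c = c * c

-- The coefficients of the product of all `rest σ + cap σ X`. The one of `X ^ w` weighs the outcomes
-- with `w` merges, in which a constant family has grown by the factor `2 ^ w`.
ε : List Step → List ℕ
ε []       = 1 ∷ []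
ε (σ ∷ σs) = mix (rest σ) (cap σ) 0 (ε σs)

scale-++ : ∀ ρs σs → scale (ρs ++ σs) ≡ scale σs * scale ρs
scale-++ []       σs = sym (*-identityʳ (scale σs))
scale-++ (ρ ∷ ρs) σs rewrite scale-++ ρs σs = ring (rest ρ + cap ρ) (scale σs) (scale ρs)
  where
  ring : ∀ a b c → a * (b * c) ≡ b * (a * c)
  ring = solve-∀

-- Only the losses during `ρs` use the true multiplicities. When `σs` begins, they are replaced by
-- their bound `c`, doubled once for every merge.
Φ-++ : ∀ ρs σs μ c → (∀ d → μ d ≤ c) →
       Φ (ρs ++ σs) μ ≤ scale σs * Φ ρs μ + dot (ε ρs) (λ c → Φ σs (const c)) c
Φ-++ []       σs μ c μ≤c = begin
  Φ σs μ                             ≤⟨ Φ-mono σs μ≤c ⟩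
  Φ σs (const c)                     ≡⟨ ring (scale σs) _ ⟩
  scale σs * 0 + (1 * Φ σs (const c) + 0)  ∎
  where
  open ≤-Reasoning
  ring : ∀ s a → a ≡ s * 0 + (1 * a + 0)
  ring = solve-∀
Φ-++ (ρ ∷ ρs) σs μ c μ≤c = begin
  E * scale (ρs ++ σs) + (r * Φ (ρs ++ σs) μ + l * Φ (ρs ++ σs) (merge p μ))
    ≤⟨ +-mono-≤ (≤-reflexive (cong (E *_) (scale-++ ρs σs)))
                (+-mono-≤ (*-monoʳ-≤ r (Φ-++ ρs σs μ c μ≤c))
                          (*-monoʳ-≤ l (Φ-++ ρs σs (merge p μ) (c + c) (λ d → +-mono-≤ (μ≤c d) (μ≤c (p * d)))))) ⟩
  E * (S * R) + (r * (S * A + dot (ε ρs) F c) + l * (S * B + dot (ε ρs) F (c + c)))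
    ≡⟨ ring E S R r l A B (F c) (dot (ε ρs) F c) (dot (ε ρs) F (c + c)) ⟩
  S * (E * R + (r * A + l * B)) + (l * 0 * F c + (r * dot (ε ρs) F c + l * dot (ε ρs) F (c + c)))
    ≡⟨ cong (S * (E * R + (r * A + l * B)) +_) (dot-mix r l 0 (ε ρs) F c) ⟨
  S * (E * R + (r * A + l * B)) + dot (mix r l 0 (ε ρs)) F c ∎
  where
  open ≤-Reasoning
  p = modulus ρ
  r = rest ρ
  l = cap ρ
  E = excess ρ (μ p)
  S = scale σs
  R = scale ρs
  A = Φ ρs μ
  B = Φ ρs (merge p μ)
  F : ℕ → ℕ
  F c = Φ σs (const c)
  ring : ∀ E S R r l A B f x y → E * (S * R) + (r * (S * A + x) + l * (S * B + y)) ≡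
         S * (E * R + (r * A + l * B)) + (l * 0 * f + (r * x + l * y))
  ring = solve-∀

-- Lists of primes by trial division

-- The library's prime? tries all divisors below n, which is too slow for the computation below.
trial : ∀ f e n → .{{NonTrivial n}} → (2 + e) Rough n → n ≤ 2 + e + f → Dec (Prime n)
trial f e n rough n≤ with n <? (2 + e) * (2 + e)
... | yes n<d² = yes (rough∧square>⇒prime rough n<d²)
trial zero e n rough n≤ | no n≮d² =
  contradiction (≤-<-trans (≤-trans n≤ (≤-reflexive (+-identityʳ _))) (m<m*n (2 + e) (2 + e) (s≤s (s≤s z≤n)))) n≮d²
trial (suc f) e n rough n≤ | no n≮d² with (2 + e) ∣? n
... | yes d∣n = no λ { (prime ¬composite) → ¬composite (hasNonTrivialDivisor {divisor = 2 + e}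
                  (<-≤-trans (m<m*n (2 + e) (2 + e) (s≤s (s≤s z≤n))) (≮⇒≥ n≮d²)) d∣n) }
... | no  d∤n = trial f (suc e) n (∤⇒rough-suc d∤n rough) (≤-trans n≤ (≤-reflexive (+-suc (2 + e) f)))

isPrime? : ∀ n → Dec (Prime n)
isPrime? 0 = no ¬prime[0]
isPrime? 1 = no ¬prime[1]
isPrime? (suc (suc m)) = trial m 0 (2 + m) 2-rough ≤-refl

primesFrom : ℕ → ℕ → List ℕ
primesFrom n zero    = []
primesFrom n (suc k) with isPrime? n
... | yes _ = n ∷ primesFrom (suc n) k
... | no  _ = primesFrom (suc n) k

cuts : ℕ → ℕ → List Step
cuts n k = map cut (primesFrom n k)

cut-rest : ∀ p → 2 ≤ p → 4 * p ∸ 5 + 5 ≡ 4 * p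
cut-rest p 2≤p = m∸n+n≡m (≤-trans (s≤s (s≤s (s≤s (s≤s (s≤s z≤n))))) (*-monoʳ-≤ 4 2≤p))

-- Second-moment bound for the large primes

wheelPrimes : List ℕ
wheelPrimes = 2 ∷ 3 ∷ 5 ∷ 7 ∷ 11 ∷ []

spoke? : ∀ r → Dec (All (λ q → ¬ q ∣ r) wheelPrimes)
spoke? r = All.all? (λ q → ¬? (q ∣? r)) wheelPrimes

-- A wheel prime dividing `r` would divide the prime `n`, which is larger.
prime⇒spoke : ∀ {n} M b r → All (λ q → q ∣ M × 1 < q × q < n) wheelPrimes → n ≡ M * b + r → Prime n →
              All (λ q → ¬ q ∣ r) wheelPrimes
prime⇒spoke {n} M b r wheel n≡ pr = All.map spoke wheel
  where
  spoke : ∀ {q} → q ∣ M × 1 < q × q < n → ¬ q ∣ r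
  spoke {q} (q∣M , 1<q , q<n) q∣r
    with prime⇒irreducible pr (subst (q ∣_) (sym n≡) (∣m∣n⇒∣m+n (∣-trans q∣M (m∣m*n b)) q∣r))
  ... | inj₁ refl = <-irrefl refl 1<q
  ... | inj₂ refl = <-irrefl refl q<n

-- The inequality of arithmetic and geometric means for `n` and `5c - n`. It bounds the loss at a
-- prime `n` by a second moment.
4n[5c∸n]≤25c² : ∀ n c → 4 * n * (5 * c ∸ n) ≤ 25 * (c * c)
4n[5c∸n]≤25c² n c with ≤-total (5 * c) n
... | inj₁ 5c≤n rewrite m≤n⇒m∸n≡0 5c≤n | *-zeroʳ (4 * n) = z≤n
... | inj₂ n≤5c = begin
  4 * n * e                ≤⟨ amgm n e ⟩
  (n + e) * (n + e)        ≡⟨ cong₂ _*_ n+e≡5c n+e≡5c ⟩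
  5 * c * (5 * c)          ≡⟨ ring c ⟩
  25 * (c * c)             ∎
  where
  open ≤-Reasoning
  e = 5 * c ∸ n
  n+e≡5c : n + e ≡ 5 * c
  n+e≡5c = m+[n∸m]≡n n≤5c
  ring : ∀ c → 5 * c * (5 * c) ≡ 25 * (c * c)
  ring = solve-∀
  diff : ∀ n d → 4 * n * (n + d) + d * d ≡ (n + (n + d)) * (n + (n + d))
  diff = solve-∀
  diff′ : ∀ n d → 4 * (n + d) * n + d * d ≡ (n + d + n) * (n + d + n)
  diff′ = solve-∀
  amgm : ∀ n e → 4 * n * e ≤ (n + e) * (n + e)
  amgm n e with ≤-total n e
  ... | inj₁ n≤e = subst (λ e → 4 * n * e ≤ (n + e) * (n + e)) (m+[n∸m]≡n n≤e)
                     (≤-trans (m≤m+n _ _) (≤-reflexive (diff n (e ∸ n))))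
  ... | inj₂ e≤n = subst (λ n → 4 * n * e ≤ (n + e) * (n + e)) (m+[n∸m]≡n e≤n)
                     (≤-trans (m≤m+n _ _) (≤-reflexive (diff′ e (n ∸ e))))

-- For large `n` and `x = τ / n` this amounts to `75 x² + 60 x ≤ 16`, which holds at `x = 5/24` with
-- a little room.
cut-tail-key : ∀ τ n → 24 * τ ≤ 5 * n → 64 ≤ n → τ * (75 * suc τ + 60 * n) ≤ 16 * n * n
cut-tail-key τ n 24τ≤5n 64≤n = *-cancelˡ-≤ 576 (begin
  576 * (τ * (75 * suc τ + 60 * n))                          ≡⟨ left τ n ⟩
  24 * τ * (75 * (24 * τ) + (1800 + 1440 * n))               ≤⟨ *-mono-≤ 24τ≤5n (+-monoˡ-≤ _ (*-monoʳ-≤ 75 24τ≤5n)) ⟩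
  5 * n * (75 * (5 * n) + (1800 + 1440 * n))                 ≡⟨ middle n ⟩
  9075 * (n * n) + n * 9000
    -- Here `576 * 16 = 9216 = 9075 + 141`, and `9000 ≤ 141 * 64`.
    ≤⟨ +-monoʳ-≤ (9075 * (n * n)) (*-monoʳ-≤ n (≤-trans (m≤m+n 9000 24) (*-monoʳ-≤ 141 64≤n))) ⟩
  9075 * (n * n) + n * (141 * n)                             ≡⟨ right n ⟩
  576 * (16 * n * n)                                         ∎)
  where
  open ≤-Reasoning
  left : ∀ τ n → 576 * (τ * (75 * (1 + τ) + 60 * n)) ≡ 24 * τ * (75 * (24 * τ) + (1800 + 1440 * n))
  left = solve-∀
  middle : ∀ n → 5 * n * (75 * (5 * n) + (1800 + 1440 * n)) ≡ 9075 * (n * n) + n * 9000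
  middle = solve-∀
  right : ∀ n → 9075 * (n * n) + n * (141 * n) ≡ 576 * (16 * n * n)
  right = solve-∀

-- Passes backwards over a prime `n`, from `τ + 1` after it to `τ` before it. The loss is at most
-- `25 c² / (4 n)` by `4n[5c∸n]≤25c²`, and since a doubled family has second moment `4 c²`, the
-- average second moment grows by the factor `(4 n + 15) / (4 n)`.
cut-tail-step : ∀ τ n c S f₁ f₂ → 24 * τ ≤ 5 * n → 64 ≤ n →
  3 * suc τ * f₁ ≤ c * c * S → 3 * suc τ * f₂ ≤ (c + c) * (c + c) * S →
  3 * τ * ((5 * c ∸ n) * S + ((4 * n ∸ 5) * f₁ + 5 * f₂)) ≤ c * c * ((4 * n ∸ 5 + 5) * S)
cut-tail-step τ n c S f₁ f₂ 24τ≤5n 64≤n h₁ h₂ = *-cancelˡ-≤ (4 * n * suc τ) {{4n[1+τ]≢0}} (begin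
  4 * n * suc τ * (3 * τ * (x * S + (a * f₁ + 5 * f₂)))
    ≡⟨ expand n τ x S a f₁ f₂ ⟩
  3 * τ * suc τ * S * (4 * n * x) + τ * (4 * n) * (a * (3 * suc τ * f₁) + 5 * (3 * suc τ * f₂))
    ≤⟨ +-mono-≤ (*-monoʳ-≤ (3 * τ * suc τ * S) (4n[5c∸n]≤25c² n c))
                (*-monoʳ-≤ (τ * (4 * n)) (+-mono-≤ (*-monoʳ-≤ a h₁) (*-monoʳ-≤ 5 h₂))) ⟩
  3 * τ * suc τ * S * (25 * (c * c)) + τ * (4 * n) * (a * (c * c * S) + 5 * ((c + c) * (c + c) * S))
    ≡⟨ collect-terms n τ c S a ⟩
  c * c * S * (τ * (75 * suc τ + 4 * n * ((a + 5) + 15)))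
    ≡⟨ cong (λ b → c * c * S * (τ * (75 * suc τ + 4 * n * (b + 15)))) a+5≡ ⟩
  c * c * S * (τ * (75 * suc τ + 4 * n * (4 * n + 15)))
    ≡⟨ split n τ (c * c * S) ⟩
  c * c * S * (τ * (75 * suc τ + 60 * n) + 16 * n * n * τ)
    ≤⟨ *-monoʳ-≤ (c * c * S) (+-monoˡ-≤ (16 * n * n * τ) (cut-tail-key τ n 24τ≤5n 64≤n)) ⟩
  c * c * S * (16 * n * n + 16 * n * n * τ)
    ≡⟨ recombine n τ c S ⟩
  4 * n * suc τ * (c * c * (4 * n * S))
    ≡⟨ cong (λ b → 4 * n * suc τ * (c * c * (b * S))) a+5≡ ⟨
  4 * n * suc τ * (c * c * ((a + 5) * S)) ∎)
  where
  open ≤-Reasoning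
  x = 5 * c ∸ n
  a = 4 * n ∸ 5
  a+5≡ : a + 5 ≡ 4 * n
  a+5≡ = cut-rest n (≤-trans (s≤s (s≤s z≤n)) 64≤n)
  4n[1+τ]≢0 : NonZero (4 * n * suc τ)
  4n[1+τ]≢0 = >-nonZero (*-mono-≤ (*-mono-≤ (s≤s (z≤n {3})) (≤-trans (s≤s z≤n) 64≤n)) (s≤s (z≤n {τ})))
  expand : ∀ n τ x S a f g → 4 * n * (1 + τ) * (3 * τ * (x * S + (a * f + 5 * g))) ≡
    3 * τ * (1 + τ) * S * (4 * n * x) + τ * (4 * n) * (a * (3 * (1 + τ) * f) + 5 * (3 * (1 + τ) * g))
  expand = solve-∀
  collect-terms : ∀ n τ c S a →
    3 * τ * (1 + τ) * S * (25 * (c * c)) + τ * (4 * n) * (a * (c * c * S) + 5 * ((c + c) * (c + c) * S)) ≡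
    c * c * S * (τ * (75 * (1 + τ) + 4 * n * ((a + 5) + 15)))
  collect-terms = solve-∀
  split : ∀ n τ K → K * (τ * (75 * (1 + τ) + 4 * n * (4 * n + 15))) ≡
    K * (τ * (75 * (1 + τ) + 60 * n) + 16 * n * n * τ)
  split = solve-∀
  recombine : ∀ n τ c S → c * c * S * (16 * n * n + 16 * n * n * τ) ≡ 4 * n * (1 + τ) * (c * c * (4 * n * S))
  recombine = solve-∀

-- Checks that at every spoke r the number w of smaller spokes is at most (5 r + 120) / 24, so that the
-- number τ of spokes below n satisfies 24 τ ≤ 5 n from the fifth turn of the wheel on.
sparse : ℕ → ℕ → ℕ → ℕ → Bool
sparse φ zero    r w = w ≤ᵇ φ
sparse φ (suc m) r w with spoke? r
... | yes _ = (24 * w ≤ᵇ 5 * r + 120) ∧ sparse φ m (suc r) (suc w)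
... | no  _ = sparse φ m (suc r) w

-- After division by `scale` the bound is `c² / (3 τ)`, whatever `k` is. In its use `τ` counts
-- spokes below `n`, which stand in for the primes.
TailBound : ℕ → ℕ → ℕ → Set
TailBound τ n k = ∀ c → 3 * τ * Φ (cuts n k) (const c) ≤ c * c * scale (cuts n k)

TailBound-anti : ∀ {τ τ′} n k → τ ≤ τ′ → TailBound τ′ n k → TailBound τ n k
TailBound-anti n k τ≤τ′ bound c = ≤-trans (*-monoˡ-≤ (Φ (cuts n k) (const c)) (*-monoʳ-≤ 3 τ≤τ′)) (bound c)

module _ (M φ : ℕ)
         (wheel   : All (λ q → q ∣ suc M × 1 < q × q < 64) wheelPrimes)
         (64≤M    : 64 ≤ suc M)
         (density : 24 * φ + 30 ≤ 5 * suc M)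
         (ok₀     : T (sparse φ (suc M) 0 0)) where

  64≤ : ∀ {n} b r → n ≡ suc M * b + r → 4 ≤ b → 64 ≤ n
  64≤ (suc b) r refl 4≤b = ≤-trans 64≤M (≤-trans (m≤m*n (suc M) (suc b)) (m≤m+n _ r))

  24τ≤5n : ∀ {n} b r w → n ≡ suc M * b + r → 4 ≤ b → 24 * w ≤ 5 * r + 120 → 24 * (φ * b + w) ≤ 5 * n
  24τ≤5n b r w refl 4≤b 24w≤ = begin
    24 * (φ * b + w)                        ≡⟨ left φ b w ⟩
    -- The 120 allowed by `sparse` is `30 * 4`: `density` leaves 30 to spare in every turn, and four
    -- turns are complete.
    24 * φ * b + 24 * w                     ≤⟨ +-monoʳ-≤ (24 * φ * b) 24w≤ ⟩
    24 * φ * b + (5 * r + 30 * 4)           ≤⟨ +-monoʳ-≤ (24 * φ * b) (+-monoʳ-≤ (5 * r) (*-monoʳ-≤ 30 4≤b)) ⟩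
    24 * φ * b + (5 * r + 30 * b)           ≡⟨ middle (24 * φ) b r ⟩
    (24 * φ + 30) * b + 5 * r               ≤⟨ +-monoˡ-≤ (5 * r) (*-monoˡ-≤ b density) ⟩
    5 * suc M * b + 5 * r                   ≡⟨ right (suc M) b r ⟩
    5 * (suc M * b + r)                     ∎
    where
    open ≤-Reasoning
    left : ∀ φ b w → 24 * (φ * b + w) ≡ 24 * φ * b + 24 * w
    left = solve-∀
    middle : ∀ a b r → a * b + (5 * r + 30 * b) ≡ (a + 30) * b + 5 * r
    middle = solve-∀
    right : ∀ M b r → 5 * M * b + 5 * r ≡ 5 * (M * b + r)
    right = solve-∀

  -- Induction on `k`, with `n` at position `r` of turn `b`. A prime is a spoke, so `τ` increases by
  -- one there, as `cut-tail-step` demands; at a composite spoke the increase is given away by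
  -- `TailBound-anti`.
  tail-bound : ∀ k {n} b r w m → n ≡ suc M * b + r → r + m ≡ M → 4 ≤ b → T (sparse φ (suc m) r w) →
               TailBound (φ * b + w) n k
  tail-next  : ∀ k {n} b r w m → n ≡ suc M * b + r → r + m ≡ M → 4 ≤ b → T (sparse φ m (suc r) w) →
               TailBound (φ * b + w) (suc n) k

  tail-bound zero    b r w m n≡ r+m≡ 4≤b ok c = ≤-trans (≤-reflexive (*-zeroʳ (3 * (φ * b + w)))) z≤n
  tail-bound (suc k) {n} b r w m n≡ r+m≡ 4≤b ok c with isPrime? n | spoke? r | ok
  ... | no _   | no _  | ok′ = tail-next k b r w m n≡ r+m≡ 4≤b ok′ c
  ... | no _   | yes _ | ok′ = TailBound-anti (suc n) k (+-monoʳ-≤ (φ * b) (n≤1+n w))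
          (tail-next k b r (suc w) m n≡ r+m≡ 4≤b (proj₂ (Equivalence.to T-∧ ok′))) c
  ... | yes pr | no ¬s | _   = contradiction (prime⇒spoke (suc M) b r wheel′ n≡ pr) ¬s
    where
    wheel′ : All (λ q → q ∣ suc M × 1 < q × q < n) wheelPrimes
    wheel′ = All.map (λ { (q∣M , 1<q , q<64) → q∣M , 1<q , <-≤-trans q<64 (64≤ b r n≡ 4≤b) }) wheel
  ... | yes pr | yes _ | ok′ =
    cut-tail-step (φ * b + w) n c (scale (cuts (suc n) k)) _ _
      (24τ≤5n b r w n≡ 4≤b (≤ᵇ⇒≤ _ _ (proj₁ (Equivalence.to T-∧ ok′)))) (64≤ b r n≡ 4≤b)
      (bound c) (bound (c + c))
    where
    bound : TailBound (suc (φ * b + w)) (suc n) k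
    bound = subst (λ τ → TailBound τ (suc n) k) (+-suc (φ * b) w)
              (tail-next k b r (suc w) m n≡ r+m≡ 4≤b (proj₂ (Equivalence.to T-∧ ok′)))

  tail-next k b r w (suc m) n≡ r+m≡ 4≤b ok =
    tail-bound k b (suc r) w m (trans (cong suc n≡) (sym (+-suc (suc M * b) r))) (trans (sym (+-suc r m)) r+m≡) 4≤b ok
  tail-next k {n} b r w zero n≡ r+m≡ 4≤b ok =
    -- The turn is complete with `w ≤ φ` spokes counted; the next one starts afresh from `ok₀`.
    TailBound-anti (suc n) k τ≤ (tail-bound k (suc b) 0 0 M n≡′ refl (m≤n⇒m≤1+n 4≤b) ok₀)
    where
    τ≤ : φ * b + w ≤ φ * suc b + 0
    τ≤ = ≤-trans (+-monoʳ-≤ (φ * b) (≤ᵇ⇒≤ w φ ok)) (≤-reflexive (ring φ b))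
      where
      ring : ∀ φ b → φ * b + φ ≡ φ * (1 + b) + 0
      ring = solve-∀
    n≡′ : suc n ≡ suc M * suc b + 0
    n≡′ = trans (cong suc n≡) (trans (cong (λ r → suc (suc M * b + r)) (trans (sym (+-identityʳ r)) r+m≡)) (ring M b))
      where
      ring : ∀ M b → 1 + ((1 + M) * b + M) ≡ (1 + M) * (1 + b) + 0
      ring = solve-∀

-- Fixed-point computation for the primes of middle size

-- u holds (rounded up) the weights of the constant families 2 ^ w with w < W, h a bound for the second
-- moment of those with w ≥ W in units of 1 / D, and A the losses so far.
module Run (D W B : ℕ) where

  run : ℕ → ℕ → List ℕ → ℕ → ℕ → Bool
  run zero    n u h A = dot u sqr 1 + h + D * A ≤ᵇ B
  run (suc k) n u h A with isPrime? n
  ... | no  _ = run k (suc n) u h A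
  ... | yes _ = run k (suc n) (take W v)
                  -- The second moment held in `h` grows by `(4 n + 15) / (4 n)` as before, and the
                  -- weights cut off at `W` join it. In the loss below, `h` itself suffices for
                  -- these families because `5 c ∸ n ≤ c²`.
                  ((4 * n + 15) * h ⌈/⌉ (4 * n) + dot (drop W v) sqr (2 ^ W))
                  (A + (dot u (λ c → 5 * c ∸ n) 1 + h) ⌈/⌉ (4 * n))
    where
    v : List ℕ
    v = map (_⌈/⌉ (4 * n)) (mix (4 * n ∸ 5) 5 0 u)

  Dominates : ℕ → List Step → Set
  Dominates Λ σs = ∀ c → D * Φ σs (const c) ≤ c * c * Λ

  -- The invariant of `run`: the remaining cost of the weights `u`, that of the moment `h` at the
  -- rate `Λ` of `Dominates`, and the past losses `A` together stay within the budget `B`.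
  Within : ℕ → List ℕ → ℕ → ℕ → List Step → Set
  Within Λ u h A σs = D * dot u (λ c → Φ σs (const c)) 1 + h * Λ + D * A * scale σs ≤ B * scale σs

  dot-dominated : ∀ {Λ} σs u c → Dominates Λ σs → D * dot u (λ c → Φ σs (const c)) c ≤ dot u sqr c * Λ
  dot-dominated {Λ} σs u c dom = begin
    D * dot u (λ c → Φ σs (const c)) c    ≡⟨ dot-*ˡ u (λ c → Φ σs (const c)) D c ⟨
    dot u (λ c → D * Φ σs (const c)) c    ≤⟨ dot-mono u c dom ⟩
    dot u (λ c → c * c * Λ) c             ≡⟨ dot-*ʳ u sqr Λ c ⟩
    dot u sqr c * Λ                   ∎
    where open ≤-Reasoning

  -- The polynomial `c² - 5 c + 7` has negative discriminant.
  5c∸n≤c² : ∀ n c → 7 ≤ n → 5 * c ∸ n ≤ c * c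
  5c∸n≤c² n c 7≤n = m≤n+o⇒m∸n≤o (5 * c) n (≤-trans (small c) (+-monoˡ-≤ (c * c) 7≤n))
    where
    small : ∀ c → 5 * c ≤ 7 + c * c
    small 0 = z≤n
    small 1 = m≤m+n 5 3
    small 2 = m≤m+n 10 1
    small 3 = m≤m+n 15 1
    small 4 = m≤m+n 20 3
    small c@(suc (suc (suc (suc (suc b))))) =
      ≤-trans (*-monoˡ-≤ c {5} {c} (m≤m+n 5 b)) (m≤n+m (c * c) 7)

  dominates-cut : ∀ n {Λ} σs → 7 ≤ n → Dominates Λ σs →
                  Dominates (D * scale σs + (4 * n + 15) * Λ) (cut n ∷ σs)
  dominates-cut n {Λ} σs 7≤n dom c = begin
    D * ((5 * c ∸ n) * S + (a * F c + 5 * F (c + c)))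
      ≡⟨ expand D (5 * c ∸ n) S a (F c) (F (c + c)) ⟩
    (5 * c ∸ n) * (D * S) + (a * (D * F c) + 5 * (D * F (c + c)))
      ≤⟨ +-mono-≤ (*-monoˡ-≤ (D * S) (5c∸n≤c² n c 7≤n))
                  (+-mono-≤ (*-monoʳ-≤ a (dom c)) (*-monoʳ-≤ 5 (dom (c + c)))) ⟩
    c * c * (D * S) + (a * (c * c * Λ) + 5 * ((c + c) * (c + c) * Λ))
      ≡⟨ contract c (D * S) a Λ ⟩
    c * c * (D * S + (a + 5 + 15) * Λ)
      ≡⟨ cong (λ b → c * c * (D * S + (b + 15) * Λ)) (cut-rest n (≤-trans (s≤s (s≤s z≤n)) 7≤n)) ⟩
    c * c * (D * S + (4 * n + 15) * Λ) ∎
    where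
    open ≤-Reasoning
    S = scale σs
    a = 4 * n ∸ 5
    F : ℕ → ℕ
    F c = Φ σs (const c)
    expand : ∀ D x S a f g → D * (x * S + (a * f + 5 * g)) ≡ x * (D * S) + (a * (D * f) + 5 * (D * g))
    expand = solve-∀
    contract : ∀ c E a Λ → c * c * E + (a * (c * c * Λ) + 5 * ((c + c) * (c + c) * Λ)) ≡
               c * c * (E + (a + 5 + 15) * Λ)
    contract = solve-∀

  -- Undoes one pass of `run`: rounding up and replacing the families from `2 ^ W` on by their
  -- second moment can only raise the cost.
  within-cut : ∀ n {Λ} σs u h A → 7 ≤ n → Dominates Λ σs →
    let v = map (_⌈/⌉ (4 * n)) (mix (4 * n ∸ 5) 5 0 u) in
    Within Λ (take W v) ((4 * n + 15) * h ⌈/⌉ (4 * n) + dot (drop W v) sqr (2 ^ W))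
             (A + (dot u (λ c → 5 * c ∸ n) 1 + h) ⌈/⌉ (4 * n)) σs →
    Within (D * scale σs + (4 * n + 15) * Λ) u h A (cut n ∷ σs)
  within-cut n@(suc _) {Λ} σs u h A 7≤n dom within = begin
    D * dot u G 1 + h * (D * S + (4 * n + 15) * Λ) + D * A * ((a + 5) * S)
      ≡⟨ cong₂ (λ x y → D * x + h * (D * S + (4 * n + 15) * Λ) + D * A * (y * S)) dotG a+5≡ ⟩
    D * (K * S + dot m F 1) + h * (D * S + (4 * n + 15) * Λ) + D * A * (4 * n * S)
      ≤⟨ +-monoˡ-≤ _ (+-monoˡ-≤ _ (*-monoʳ-≤ D (+-monoʳ-≤ (K * S) (dot-⌈/⌉ (4 * n) m F 1)))) ⟩
    D * (K * S + 4 * n * dot v F 1) + h * (D * S + (4 * n + 15) * Λ) + D * A * (4 * n * S)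
      ≡⟨ cong (λ x → D * (K * S + 4 * n * x) + h * (D * S + (4 * n + 15) * Λ) + D * A * (4 * n * S)) dotv ⟩
    D * (K * S + 4 * n * (dt + dd)) + h * (D * S + (4 * n + 15) * Λ) + D * A * (4 * n * S)
      ≡⟨ expand D K S (4 * n) dt dd h Λ A ⟩
    4 * n * (D * dt) + 4 * n * (D * dd) + (4 * n + 15) * h * Λ + D * S * (K + h) + D * A * (4 * n * S)
      ≤⟨ +-monoˡ-≤ _ (+-mono-≤ (+-mono-≤ (+-monoʳ-≤ (4 * n * (D * dt)) (*-monoʳ-≤ (4 * n) (dot-dominated σs (drop W v) (2 ^ W) dom)))
                                         (*-monoˡ-≤ Λ (≤*⌈/⌉ ((4 * n + 15) * h) (4 * n))))
                               (*-monoʳ-≤ (D * S) (≤*⌈/⌉ (K + h) (4 * n)))) ⟩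
    4 * n * (D * dt) + 4 * n * (q * Λ) + 4 * n * h′ * Λ + D * S * (4 * n * A′) + D * A * (4 * n * S)
      ≡⟨ contract (4 * n) (D * dt) q Λ h′ D S A A′ ⟩
    4 * n * (D * dt + (h′ + q) * Λ + D * (A + A′) * S)
      ≤⟨ *-monoʳ-≤ (4 * n) within ⟩
    4 * n * (B * S)
      ≡⟨ swap (4 * n) B S ⟩
    B * (4 * n * S)
      ≡⟨ cong (λ y → B * (y * S)) a+5≡ ⟨
    B * ((a + 5) * S) ∎
    where
    open ≤-Reasoning
    S = scale σs
    a = 4 * n ∸ 5
    F G : ℕ → ℕ
    F c = Φ σs (const c)
    G c = Φ (cut n ∷ σs) (const c)
    a+5≡ : a + 5 ≡ 4 * n
    a+5≡ = cut-rest n (≤-trans (s≤s (s≤s z≤n)) 7≤n)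
    m v : List ℕ
    m = mix a 5 0 u
    v = map (_⌈/⌉ (4 * n)) m
    K h′ A′ q dt dd : ℕ
    K  = dot u (λ c → 5 * c ∸ n) 1
    h′ = (4 * n + 15) * h ⌈/⌉ (4 * n)
    A′ = (K + h) ⌈/⌉ (4 * n)
    q  = dot (drop W v) sqr (2 ^ W)
    dt = dot (take W v) F 1
    dd = dot (drop W v) F (2 ^ W)
    dotG : dot u G 1 ≡ K * S + dot m F 1
    dotG = trans (dot-+ u (λ c → (5 * c ∸ n) * S) _ 1) (cong₂ _+_ (dot-*ʳ u (λ c → 5 * c ∸ n) S 1)
      (trans (dot-+ u (λ c → a * F c) (λ c → 5 * F (c + c)) 1)
      (trans (cong₂ _+_ (dot-*ˡ u F a 1) (trans (dot-*ˡ u (λ c → F (c + c)) 5 1) (cong (5 *_) (dot-double u F 1))))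
             (sym (dot-mix a 5 0 u F 1)))))
    dotv : dot v F 1 ≡ dt + dd
    dotv = trans (dot-split W v F 1) (cong (λ e → dt + dot (drop W v) F e) (*-identityʳ (2 ^ W)))
    expand : ∀ D K S N x y h Λ A →
      D * (K * S + N * (x + y)) + h * (D * S + (N + 15) * Λ) + D * A * (N * S) ≡
      N * (D * x) + N * (D * y) + (N + 15) * h * Λ + D * S * (K + h) + D * A * (N * S)
    expand = solve-∀
    contract : ∀ N x q Λ h D S A A′ →
      N * x + N * (q * Λ) + N * h * Λ + D * S * (N * A′) + D * A * (N * S) ≡
      N * (x + (h + q) * Λ + D * (A + A′) * S)
    contract = solve-∀
    swap : ∀ N B S → N * (B * S) ≡ B * (N * S)
    swap = solve-∀

  -- `Λ` is built from the far end of the range backwards, while `run` works forwards. Hence `Λ` is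
  -- chosen first and the invariant is proved for all `u`, `h` and `A`.
  run-sound : ∀ k {n m} j → 7 ≤ n → k + n ≡ m → Dominates (scale (cuts m j)) (cuts m j) →
    ∃ λ Λ → Dominates Λ (cuts n (k + j)) × (∀ u h A → T (run k n u h A) → Within Λ u h A (cuts n (k + j)))
  run-sound zero {n} j 7≤n refl dom = scale σs , dom , within
    where
    open ≤-Reasoning
    σs = cuts n j
    S = scale σs
    within : ∀ u h A → T (run zero n u h A) → Within S u h A σs
    within u h A ok = begin
      D * dot u (λ c → Φ σs (const c)) 1 + h * S + D * A * S
        ≤⟨ +-monoˡ-≤ (D * A * S) (+-monoˡ-≤ (h * S) (dot-dominated σs u 1 dom)) ⟩
      dot u sqr 1 * S + h * S + D * A * S
        ≡⟨ ring (dot u sqr 1) h (D * A) S ⟩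
      (dot u sqr 1 + h + D * A) * S
        ≤⟨ *-monoˡ-≤ S (≤ᵇ⇒≤ (dot u sqr 1 + h + D * A) B ok) ⟩
      B * S ∎
      where
      ring : ∀ a b c s → a * s + b * s + c * s ≡ (a + b + c) * s
      ring = solve-∀
  run-sound (suc k) {n} j 7≤n refl dom with isPrime? n | run-sound k {suc n} j (m≤n⇒m≤1+n 7≤n) (+-suc k n) dom
  ... | no  _ | sound = sound
  ... | yes _ | Λ , dom′ , within =
    _ , dominates-cut n (cuts (suc n) (k + j)) 7≤n dom′ ,
    λ u h A ok → within-cut n (cuts (suc n) (k + j)) u h A 7≤n dom′ (within _ _ _ ok)

-- Complete lists of primes, squarefree divisors, multiplicities

primesFrom-prime : ∀ n k → All Prime (primesFrom n k)
primesFrom-prime n zero    = []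
primesFrom-prime n (suc k) with isPrime? n
... | yes pr = pr ∷ primesFrom-prime (suc n) k
... | no  _  = primesFrom-prime (suc n) k

primesFrom-ascending : ∀ n k → Ascending n (primesFrom n k)
primesFrom-ascending n k = weaken k n ≤-refl
  where
  weaken : ∀ k n {m} → m ≤ n → Ascending m (primesFrom n k)
  weaken zero    n m≤n = tt
  weaken (suc k) n m≤n with isPrime? n
  ... | yes _ = m≤n , weaken k (suc n) ≤-refl
  ... | no  _ = weaken k (suc n) (m≤n⇒m≤1+n m≤n)

∈-primesFrom : ∀ {p} n k → Prime p → n ≤ p → p < n + k → p ∈ primesFrom n k
∈-primesFrom {p} n zero    pr n≤p p<n+k = contradiction (subst (p <_) (+-identityʳ n) p<n+k) (≤⇒≯ n≤p)
∈-primesFrom {p} n (suc k) pr n≤p p<n+k with isPrime? n | m≤n⇒m<n∨m≡n n≤p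
... | yes _  | inj₁ n<p  = there (∈-primesFrom (suc n) k pr n<p (subst (p <_) (+-suc n k) p<n+k))
... | yes _  | inj₂ refl = here refl
... | no  _  | inj₁ n<p  = ∈-primesFrom (suc n) k pr n<p (subst (p <_) (+-suc n k) p<n+k)
... | no ¬pr | inj₂ refl = contradiction pr ¬pr

prime-divisor : ∀ n .{{_ : NonZero n}} → n ≢ 1 → ∃[ p ] (Prime p × p ∣ n)
prime-divisor n n≢1 with factorise n
... | record { factors = []     ; isFactorisation = eq } = contradiction eq n≢1
... | record { factors = p ∷ ps ; isFactorisation = eq ; factorsPrime = pr ∷ _ } =
  p , pr , subst (p ∣_) (sym eq) (m∣m*n (product ps))

squareFree-∣ : ∀ {m n} → m ∣ n → SquareFree n → SquareFree m
squareFree-∣ m∣n sf p pr p²∣m = sf p pr (∣-trans p²∣m m∣n)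

-- Divides out the listed primes in turn. As `n` is squarefree, `p` does not divide the cofactor and
-- can leave the list.
squareFree-∣product : ∀ ps n .{{_ : NonZero n}} → SquareFree n → (∀ {p} → Prime p → p ∣ n → p ∈ ps) → n ∣ product ps
squareFree-∣product []       n sf covers with n ≟ 1
... | yes refl = ∣-refl
... | no  n≢1 with prime-divisor n n≢1
...   | p , pr , p∣n with () ← covers pr p∣n
squareFree-∣product (p ∷ ps) n sf covers with p ∣? n
... | no p∤n = ∣-trans (squareFree-∣product ps n sf covers′) (n∣m*n p)
  where
  covers′ : ∀ {q} → Prime q → q ∣ n → q ∈ ps
  covers′ pr q∣n with covers pr q∣n
  ... | here refl = contradiction q∣n p∤n
  ... | there q∈  = q∈
... | yes (divides q refl) =
  subst (_∣ p * product ps) (*-comm p q) (*-monoʳ-∣ p (squareFree-∣product ps q (squareFree-∣ (m∣m*n p) sf) covers′))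
  where
  instance _ = m*n≢0⇒m≢0 q
  covers′ : ∀ {s} → Prime s → s ∣ q → s ∈ ps
  covers′ {s} pr s∣q with covers pr (∣-trans s∣q (m∣m*n p))
  ... | here refl = contradiction (*-pres-∣ s∣q (∣-refl {s})) (sf s pr)
  ... | there s∈  = s∈

indicator≤1 : ∀ {ℓ} {P : Set ℓ} (P? : Dec P) → indicator P? ≤ 1
indicator≤1 (yes _) = ≤-refl
indicator≤1 (no _)  = z≤n

indicator-no : ∀ {ℓ} {P : Set ℓ} (P? : Dec P) → ¬ P → indicator P? ≡ 0
indicator-no (yes p) ¬p = contradiction p ¬p
indicator-no (no _)  ¬p = refl

count-absent : ∀ {r} (f : Fin r → Congruence) d → (∀ j → proj₁ (f j) ≢ d) → count (tabulate f) d ≡ 0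
count-absent {zero}  f d absent = refl
count-absent {suc r} f d absent = cong₂ _+_ (indicator-no (proj₁ (f zero) ≟ d) (absent zero))
                                            (count-absent (f ∘ suc) d (absent ∘ suc))

count-injective : ∀ {r} (f : Fin r → Congruence) → Injective _≡_ _≡_ (proj₁ ∘ f) → ∀ d → count (tabulate f) d ≤ 1
count-injective {zero}  f inj d = z≤n
count-injective {suc r} f inj d with proj₁ (f zero) ≟ d
... | yes f₀≡d = +-mono-≤ (indicator≤1 (proj₁ (f zero) ≟ d)) (≤-reflexive (count-absent (f ∘ suc) d absent))
  where
  absent : ∀ j → proj₁ (f (suc j)) ≢ d
  absent j f≡d with () ← inj {suc j} {zero} (trans f≡d (sym f₀≡d))
... | no  f₀≢d = +-mono-≤ (≤-reflexive (indicator-no (proj₁ (f zero) ≟ d) f₀≢d))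
                          (count-injective (f ∘ suc) (Fin.suc-injective ∘ inj) d)

bounded : ∀ {r} (m : Fin r → ℕ) → ∃[ M ] (∀ j → m j ≤ M)
bounded {zero}  m = 0 , λ ()
bounded {suc r} m = let M , m≤M = bounded (m ∘ suc) in
  m zero ⊔ M , λ { zero → m≤m⊔n (m zero) M ; (suc j) → m≤n⇒m≤o⊔n (m zero) (m≤M j) }

-- The numerical bounds and the conclusion

χ : ℕ → ℕ
χ d = indicator (119 ≤? d)

smallPrimes : List ℕ
smallPrimes = 2 ∷ 3 ∷ 5 ∷ 7 ∷ 11 ∷ 13 ∷ []

smallSteps : List Step
smallSteps = map plain smallPrimes

scale>0 : ∀ n k → 2 ≤ n → 0 < scale (cuts n k)
scale>0 n zero    2≤n = s≤s z≤n
scale>0 n (suc k) 2≤n with isPrime? n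
... | no  _ = scale>0 (suc n) k (m≤n⇒m≤1+n 2≤n)
... | yes _ rewrite cut-rest n 2≤n =
  *-mono-≤ {1} {4 * n} (≤-trans (s≤s z≤n) (*-monoʳ-≤ 4 2≤n)) (scale>0 (suc n) k (m≤n⇒m≤1+n 2≤n))

-- `Fx` is the fixed-point unit of the weights. Cancelling `D` and `Fx` shows that the later primes
-- cost at most `B`, which fits into what the small primes leave.
within⇒Φ<scale : ∀ D Fx B Λ σs → .{{_ : NonZero D}} .{{_ : NonZero Fx}} →
  let open Run D 24 (D * (Fx * B)) in
  Within Λ (map (Fx *_) (ε smallSteps)) 0 0 σs → Φ smallSteps χ + B < scale smallSteps → 0 < scale σs →
  Φ (smallSteps ++ σs) χ < scale (smallSteps ++ σs)
within⇒Φ<scale D Fx B Λ σs within Φ+B< S>0 = begin-strict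
  Φ (smallSteps ++ σs) χ              ≤⟨ Φ-++ smallSteps σs χ 1 (λ d → indicator≤1 (119 ≤? d)) ⟩
  S * Φ smallSteps χ + dot u F 1      ≤⟨ +-monoʳ-≤ (S * Φ smallSteps χ) dot≤ ⟩
  S * Φ smallSteps χ + S * B          ≡⟨ *-distribˡ-+ S (Φ smallSteps χ) B ⟨
  S * (Φ smallSteps χ + B)            <⟨ *-monoʳ-< S {{>-nonZero S>0}} Φ+B< ⟩
  S * scale smallSteps                ≡⟨ scale-++ smallSteps σs ⟨
  scale (smallSteps ++ σs)            ∎
  where
  open ≤-Reasoning
  S = scale σs
  F : ℕ → ℕ
  F c = Φ σs (const c)
  u : List ℕ
  u = ε smallSteps
  regroup : ∀ D F B S → D * (F * B) * S ≡ D * (F * (S * B))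
  regroup = solve-∀
  dot≤ : dot u F 1 ≤ S * B
  dot≤ = *-cancelˡ-≤ Fx (*-cancelˡ-≤ D (begin
    D * (Fx * dot u F 1)              ≡⟨ cong (D *_) (dot-scale Fx u F 1) ⟨
    D * dot (map (Fx *_) u) F 1       ≤⟨ ≤-trans (m≤m+n _ 0) (m≤m+n _ (D * 0 * S)) ⟩
    D * dot (map (Fx *_) u) F 1 + 0 * Λ + D * 0 * S  ≤⟨ within ⟩
    D * (Fx * B) * S                  ≡⟨ regroup D Fx B S ⟩
    D * (Fx * (S * B))                ∎))

sparse-2310 : T (sparse 480 2310 0 0)
sparse-2310 = _

wheel-2310 : All (λ q → q ∣ 2310 × 1 < q × q < 64) wheelPrimes
wheel-2310 = toWitness {a? = All.all? (λ q → (q ∣? 2310) ×-dec (1 <? q) ×-dec (q <? 64)) wheelPrimes} _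

-- Four turns of the wheel: `9240 = 4 * 2310` and `1920 = 4 * 480`. The density condition holds with
-- equality, `24 * 480 + 30 = 5 * 2310`.
tail-9240 : ∀ j → TailBound 1920 9240 j
tail-9240 j =
  tail-bound 2309 480 wheel-2310 (m≤m+n 64 2246) ≤-refl sparse-2310 j 4 0 0 2309 refl refl ≤-refl sparse-2310

run⇒Φ<scale : ∀ D Fx B n K N → .{{_ : NonZero D}} .{{_ : NonZero Fx}} → 7 ≤ n → K + n ≡ N →
  (∀ j → Run.Dominates D 24 (D * (Fx * B)) (scale (cuts N j)) (cuts N j)) →
  T (Run.run D 24 (D * (Fx * B)) K n (map (Fx *_) (ε smallSteps)) 0 0) →
  Φ smallSteps χ + B < scale smallSteps →
  ∀ j → Φ (smallSteps ++ cuts n (K + j)) χ < scale (smallSteps ++ cuts n (K + j))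
run⇒Φ<scale D Fx B n K N 7≤n K+n≡N dom ok Φ+B< j =
  let Λ , _ , within = Run.run-sound D 24 (D * (Fx * B)) K j 7≤n K+n≡N (dom j)
  in within⇒Φ<scale D Fx B Λ (cuts n (K + j)) (within (map (Fx *_) (ε smallSteps)) 0 0 ok) Φ+B<
       (scale>0 n (K + j) (≤-trans (m≤m+n 2 5) 7≤n))

small-excess : Φ smallSteps χ + 27567 < scale smallSteps
small-excess = <ᵇ⇒< (Φ smallSteps χ + 27567) (scale smallSteps) _


-- 5760 = 3 * 1920 is the constant of tail-9240, and 27567 + 1 is what Φ smallSteps χ = 2462 leaves of
-- scale smallSteps = 30030.
potential-small : ∀ j → Φ (smallSteps ++ cuts 14 (9226 + j)) χ < scale (smallSteps ++ cuts 14 (9226 + j))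
potential-small = run⇒Φ<scale 5760 (10 ^ 20) 27567 14 9226 9240 (m≤m+n 7 7) refl tail-9240 _ small-excess

steps : ℕ → List Step
steps k = smallSteps ++ cuts 14 k

admissible-plain : ∀ {p} → Prime p → Admissible (plain p)
admissible-plain {p} pr = pr , ≤-reflexive (begin-equality
  p ∸ 1 + 1 + 0  ≡⟨ +-identityʳ (p ∸ 1 + 1) ⟩
  p ∸ 1 + 1      ≡⟨ m∸n+n≡m (>-nonZero⁻¹ p {{prime⇒nonZero pr}}) ⟩
  p              ≡⟨ *-identityˡ p ⟨
  1 * p          ∎)
  where open ≤-Reasoning

admissible-cut : ∀ {p} → Prime p → Admissible (cut p)
admissible-cut {p} pr = pr , ≤-reflexive (trans
  (cong (_+ p) (cut-rest p (nonTrivial⇒n>1 p {{prime⇒nonTrivial pr}})))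
  (+-comm (4 * p) p))

steps-admissible : ∀ k → All Admissible (steps k)
steps-admissible k = ++⁺
  (map⁺ {f = plain} (All.map {P = Prime} {Q = Admissible ∘ plain} admissible-plain
    (toWitness {a? = All.all? prime? smallPrimes} _)))
  (map⁺ {f = cut} (All.map {P = Prime} {Q = Admissible ∘ cut} admissible-cut (primesFrom-prime 14 k)))

moduli-cuts : ∀ n k → moduli (cuts n k) ≡ primesFrom n k
moduli-cuts n k = trans (sym (map-∘ (primesFrom n k))) (map-id (primesFrom n k))

steps-ascending : ∀ k → Ascending 2 (moduli (steps k))
steps-ascending k = m≤m+n 2 0 , m≤m+n 3 0 , m≤m+n 4 1 , m≤m+n 6 1 , m≤m+n 8 3 , m≤m+n 12 1 ,
  subst (Ascending 14) (sym (moduli-cuts 14 k)) (primesFrom-ascending 14 k)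

∈-moduli : ∀ {p} k → Prime p → p < 14 + k → p ∈ moduli (steps k)
∈-moduli {p} k pr p<14+k with p <? 14
... | yes p<14 = ∈-++⁺ˡ (∈-primesFrom 2 12 pr (nonTrivial⇒n>1 p {{prime⇒nonTrivial pr}}) p<14)
... | no  p≮14 = ∈-++⁺ʳ smallPrimes (subst (p ∈_) (sym (moduli-cuts 14 k)) (∈-primesFrom 14 k pr (≮⇒≥ p≮14) p<14+k))

record Sieve (N : ℕ) : Set where
  field
    stages     : List Step
    admissible : All Admissible stages
    ascending  : Ascending 2 (moduli stages)
    complete   : ∀ {p} → Prime p → p ≤ N → p ∈ moduli stages
    small      : Φ stages χ < scale stages

-- Distinct moduli that are all at least 119 have multiplicities bounded by `χ`, so `Φ-mono` carries
-- the numerical bound over to them. `N` enters only through the primes that the sieve must contain.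
uncovered : ∀ {N r} → Sieve N → (a : Fin r → ℤ) (m : Fin r → ℕ) →
  (∀ j → 119 ≤ m j) → (∀ j → m j ≤ N) →
  Injective _≡_ _≡_ m → (∀ j → SquareFree (m j)) →
  ∃[ x ] (∀ j → ¬ (x ≡ a j [mod m j ]))
uncovered {N} {r} S a m 119≤m m≤N inj sf =
  let x , _ , avoids = avoid stages admissible ascending 1 primes∣1 C proper
                         (≤-<-trans (Φ-mono stages count≤χ) small) 0ℤ
  in x , tabulate⁻ avoids
  where
  open Sieve S
  c : Fin r → Congruence
  c j = m j , a j
  C : List Congruence
  C = tabulate c
  primes∣1 : ∀ {q} → Prime q → q ∣ 1 → q < 2
  primes∣1 pr q∣1 = s≤s (∣⇒≤ q∣1)
  proper : All (Proper (product (moduli stages))) C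
  proper = tabulate⁺ λ j →
    let instance m≢0 = >-nonZero (≤-trans (m≤m+n 1 118) (119≤m j)) in
    squareFree-∣product (moduli stages) (m j) (sf j) (λ pr p∣m → complete pr (≤-trans (∣⇒≤ p∣m) (m≤N j))) ,
    λ m≡1 → contradiction (subst (119 ≤_) m≡1 (119≤m j)) λ { (s≤s ()) }
  count≤χ : ∀ d → count C d ≤ χ d
  count≤χ d = bound d (119 ≤? d)
    where
    bound : ∀ d (big? : Dec (119 ≤ d)) → count C d ≤ indicator big?
    bound d (yes _)     = count-injective c inj d
    bound d (no  119≰d) = ≤-reflexive (count-absent c d λ j m≡d → 119≰d (subst (119 ≤_) m≡d (119≤m j)))

sieve : ∀ K → (∀ j → Φ (smallSteps ++ cuts 14 (K + j)) χ < scale (smallSteps ++ cuts 14 (K + j))) → ∀ N → Sieve N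
sieve K Φ< N = record
  { stages     = steps (K + N)
  ; admissible = steps-admissible (K + N)
  ; ascending  = steps-ascending (K + N)
  ; complete   = λ pr p≤N → ∈-moduli (K + N) pr (s≤s (≤-trans p≤N (≤-trans (m≤n+m N K) (m≤n+m (K + N) 13))))
  ; small      = Φ< N
  }

theorem1 : (r : ℕ) (a : Fin r → ℤ) (m : Fin r → ℕ) →
    IsCoveringSystem r a m →
    Injective _≡_ _≡_ m →
    (∀ j → SquareFree (m j)) →
    ∃[ j ] (m j ≤ 118)
theorem1 r a m (_ , covers) inj sf with any? (λ j → m j ≤? 118)
... | yes found = found
... | no  none  =
  let M , m≤M     = bounded m
      x , avoided = uncovered (sieve 9226 potential-small M) a m
                      (λ j → ≰⇒> (λ m≤118 → none (j , m≤118))) m≤M inj sf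
      j , hit     = covers x
  in contradiction hit (avoided j)
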